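{- For every integer $k \geq 2$, the Nyldon factorization of the Fibonacci word $F_k$ is the two-term sequence $a,\ F_k[2..f_k]$. That is, $F_k = a\cdot F_k[2..f_k]$, both $a$ and $F_k[2..f_k]$ are Nyldon words, and $a \preceq F_k[2..f_k]$.
   Context: Strings are over the binary alphabet $\{a,b\}$ ordered by $a \prec b$, and $\prec$ also denotes the induced lexicographic order on strings: $x \prec y$ iff $x$ is a proper prefix of $y$, or there is $i$ with $x[1..i-1]=y[1..i-1]$ and $x[i]\prec y[i]$; $x\preceq y$ means $x\prec y$ or $x=y$. For a string $w$, $w[i..j]$ denotes the substring from position $i$ to position $j$ (1-indexed). Nyldon words are defined recursively: every string of length $1$ is a Nyldon word; a string $w$ with $|w|\ge 2$ is a Nyldon word iff there is no factorization $w=\gamma_1\cdots\gamma_m$ with $m\ge 2$, each $\gamma_i$ a nonempty Nyldon word, and $\gamma_1\preceq\gamma_2\preceq\cdots\preceq\gamma_m$. Every nonempty string $w$ has a unique factorization $w=\gamma_1\cdots\gamma_m$ into Nyldon words with $\gamma_i\preceq\gamma_{i+1}$ for all $i$; it is called the Nyldon factorization of $w$. Fibonacci words: $F_0=b$, $F_1=a$, $F_k=F_{k-1}F_{k-2}$ for $k\ge 2$; $f_k=|F_k|$. -}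

module Defs where

open import Data.List using (List; []; _∷_; [_]; _++_; concat; drop; length; take)
open import Data.List.Properties using (length-++)
open import Data.List.Relation.Binary.Lex.Strict using (Lex-<)
open import Data.List.Relation.Unary.All using (All; []; _∷_)
import Data.List.Relation.Unary.All as All
open import Data.List.Relation.Unary.Linked using (Linked)
open import Data.Nat using (ℕ; zero; suc; _+_; _∸_; _≤_; _<_; _≥_; z≤n; s≤s)
open import Data.Nat.Properties
  using (≤-refl; ≤-reflexive; ≤-trans; ≤-pred; +-mono-≤; +-monoʳ-≤; +-comm; m≤m+n; m≤n+m)
open import Data.Product using (_×_; _,_; ∃-syntax)
open import Data.Sum using (_⊎_; inj₁; inj₂)
open import Data.Empty using (⊥)
open import Function.Bundles using (_⇔_; mk⇔)
open import Relation.Binary.PropositionalEquality using (_≡_; refl; sym; subst)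
open import Relation.Nullary using (¬_)

data Letter : Set where
  a b : Letter

data _≺ₗ_ : Letter → Letter → Set where
  a≺b : a ≺ₗ b

Word : Set
Word = List Letter

infix 4 _≺ₗ_ _≺_ _≼_

_≺_ : Word → Word → Set
_≺_ = Lex-< _≡_ _≺ₗ_

_≼_ : Word → Word → Set
x ≼ y = x ≺ y ⊎ x ≡ y

-- 1-indexed, both ends included.
_[_⋯_] : Word → ℕ → ℕ → Word
w [ i ⋯ j ] = drop (i ∸ 1) (take j w)

record IsNondecreasingFactorization (P : Word → Set) (w : Word) (γs : List Word) : Set where
  constructor mkFactorization
  field
    concat≡  : concat γs ≡ w
    factors  : All P γs
    monotone : Linked _≼_ γs

-- The right-hand side of the recursive definition of Nyldon words, with
-- P in place of the recursive occurrence.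
NyldonStep : (Word → Set) → Word → Set
NyldonStep P w =
  length w ≡ 1 ⊎
  (length w ≥ 2 ×
   ¬ (∃[ γs ] (length γs ≥ 2 × IsNondecreasingFactorization P w γs)))

-- The recursive occurrence is negative, so Nyldon cannot be an inductive
-- type; it is defined by recursion on a bound for the length of the word.
-- nyldon-unfold below shows that the bound is harmless.
NyldonUpTo : ℕ → Word → Set
NyldonUpTo zero    w = ⊥
NyldonUpTo (suc n) w = NyldonStep (NyldonUpTo n) w

Nyldon : Word → Set
Nyldon w = NyldonUpTo (length w) w

IsNyldonFactorization : Word → List Word → Set
IsNyldonFactorization = IsNondecreasingFactorization Nyldon

F : ℕ → Word
F zero          = [ b ]
F (suc zero)    = [ a ]
F (suc (suc k)) = F (suc k) ++ F k

f : ℕ → ℕ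
f k = length (F k)

private
  nonempty : ∀ n {w} → NyldonUpTo n w → 1 ≤ length w
  nonempty (suc n) (inj₁ |w|≡1)       = ≤-reflexive (sym |w|≡1)
  nonempty (suc n) (inj₂ (2≤|w| , _)) = ≤-trans (s≤s z≤n) 2≤|w|

  factor≤ : (γs : List Word) → All (λ γ → length γ ≤ length (concat γs)) γs
  factor≤ []       = []
  factor≤ (γ ∷ γs) rewrite length-++ γ {concat γs} =
    m≤m+n _ _ ∷ All.map (λ le → ≤-trans le (m≤n+m _ (length γ))) (factor≤ γs)

  factor< : (γs : List Word) → length γs ≥ 2 → All (λ γ → 1 ≤ length γ) γs →
            All (λ γ → length γ < length (concat γs)) γs
  factor< (γ ∷ δ ∷ γs) _ (1≤γ ∷ 1≤δ ∷ _) rewrite length-++ γ {δ ++ concat γs} =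
    subst (_≤ length γ + length (δ ++ concat γs)) (+-comm (length γ) 1)
      (+-monoʳ-≤ (length γ) 1≤rest)
    ∷ All.map (λ le → +-mono-≤ 1≤γ le) (factor≤ (δ ∷ γs))
    where
    1≤rest : 1 ≤ length (δ ++ concat γs)
    1≤rest rewrite length-++ δ {concat γs} = ≤-trans 1≤δ (m≤m+n _ _)
  factor< (_ ∷ []) (s≤s ()) _

  step-map : {P Q : Word → Set} (w : Word) →
             (∀ γ → Q γ → 1 ≤ length γ) →
             (∀ γ → length γ < length w → Q γ → P γ) →
             NyldonStep P w → NyldonStep Q w
  step-map w _  _   (inj₁ |w|≡1)          = inj₁ |w|≡1
  step-map w ne Q⇒P (inj₂ (2≤|w| , none)) = inj₂ (2≤|w| , λ where
    (γs , 2≤m , mkFactorization refl qs mono) →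
      none (γs , 2≤m , mkFactorization refl
        (All.zipWith (λ (lt , q) → Q⇒P _ lt q)
          (factor< γs 2≤m (All.map (ne _) qs) , qs))
        mono))

  rebound : ∀ m n w → length w ≤ m → length w ≤ n → NyldonUpTo m w → NyldonUpTo n w
  rebound (suc m) zero [] _ _ (inj₁ ())
  rebound (suc m) zero [] _ _ (inj₂ (() , _))
  rebound (suc m) (suc n) w |w|≤m |w|≤n =
    step-map w (λ _ → nonempty n)
      (λ γ lt → rebound n m γ (≤-pred (≤-trans lt |w|≤n)) (≤-pred (≤-trans lt |w|≤m)))

nyldon-unfold : ∀ w → Nyldon w ⇔ NyldonStep Nyldon w
nyldon-unfold []          = mk⇔ (λ ()) λ where
  (inj₁ ())
  (inj₂ (() , _))
nyldon-unfold w@(_ ∷ w′) = mk⇔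
  (step-map w (λ γ → nonempty (length γ))
    (λ γ lt → rebound (length γ) (length w′) γ ≤-refl (≤-pred lt)))
  (step-map w (λ _ → nonempty (length w′))
    (λ γ lt → rebound (length w′) (length γ) γ (≤-pred lt) ≤-refl))

{-# OPTIONS --safe #-}
-- Write F k = a G.  Eliminating the smallest letter turns G into a word over
-- longer and longer blocks: G a is the image of b under the substitution
-- b ↦ ba, a ↦ b iterated k ∸ 2 times and followed by b ↦ ba, a ↦ a.  By
-- induction on the level, every nondecreasing Nyldon factorization of such
-- an image of a word beginning with b cuts only in front of blocks coming
-- from b: a factor beginning with a block x that is not followed by the
-- smaller block is either x itself, which is less than its predecessor, or
-- x R with x ≼ the first Nyldon factor of R, which is not Nyldon.  At the
-- top level there is only one block, hence no cut.
module Submission where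

open import Defs
open import Data.Empty using (⊥-elim)
open import Data.List using (List; []; _∷_; [_]; _++_; concat; length; map)
open import Data.List.Properties
  using (++-assoc; ++-identityʳ; ++-conicalʳ; ∷-injective; ∷-injectiveˡ; ∷-injectiveʳ; take-all)
open import Data.List.Relation.Binary.Lex.Strict using (halt; this; next)
open import Data.List.Relation.Unary.All using (All; []; _∷_)
open import Data.List.Relation.Unary.Linked using (Linked; []; [-]; _∷_)
open import Data.Nat using (ℕ; zero; suc; _≥_; z≤n; s≤s)
open import Data.Nat.Properties using (≤-refl)
open import Data.Product using (_×_; _,_; ∃-syntax; proj₂)
open import Data.Sum using (inj₁; inj₂)
open import Function using (id; _∘_)
open import Function.Bundles using (Equivalence)
open import Relation.Binary.PropositionalEquality
  using (_≡_; _≢_; refl; sym; trans; cong; subst; module ≡-Reasoning)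
open import Relation.Nullary using (¬_)

-- Prefixes and first letters in the lexicographic order.

≼-++ : ∀ x y → x ≼ x ++ y
≼-++ []      []      = inj₂ refl
≼-++ []      (_ ∷ _) = inj₁ halt
≼-++ (c ∷ x) y with ≼-++ x y
... | inj₁ x≺xy = inj₁ (next refl x≺xy)
... | inj₂ x≡xy = inj₂ (cong (c ∷_) x≡xy)

++-⋠ : ∀ x {y} → y ≢ [] → ¬ (x ++ y ≼ x)
++-⋠ []      {[]}    y≢[] _                    = y≢[] refl
++-⋠ []      {_ ∷ _} y≢[] (inj₁ ())
++-⋠ []      {_ ∷ _} y≢[] (inj₂ ())
++-⋠ (_ ∷ x) y≢[] (inj₁ (this ()))
++-⋠ (_ ∷ x) y≢[] (inj₁ (next _ xy≺x)) = ++-⋠ x y≢[] (inj₁ xy≺x)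
++-⋠ (_ ∷ x) y≢[] (inj₂ xy≡x)          = ++-⋠ x y≢[] (inj₂ (∷-injectiveʳ xy≡x))

data StartsB : Word → Set where
  starts : ∀ {w} → StartsB (b ∷ w)

-- No letter exceeds b.
StartsB-≼ : ∀ {x y} → StartsB x → x ≼ y → StartsB y
StartsB-≼ starts (inj₁ (this ()))
StartsB-≼ starts (inj₁ (next refl _)) = starts
StartsB-≼ starts (inj₂ refl)          = starts

-- Factorizations into Nyldon words.

nyldon-≢[] : ∀ {w} → Nyldon w → w ≢ []
nyldon-≢[] () refl

-- A word of length at least 2 without any factorization would be Nyldon, hence its own one-term
-- factorization. The double negation avoids deciding `Nyldon`.
factorization-¬¬ : ∀ {w} → w ≢ [] → ¬ ¬ (∃[ γs ] IsNyldonFactorization w γs)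
factorization-¬¬ {[]}         w≢[] _    = w≢[] refl
factorization-¬¬ {x ∷ []}     _    none =
  none ([ x ∷ [] ] , mkFactorization refl (inj₁ refl ∷ []) [-])
factorization-¬¬ {w@(_ ∷ _ ∷ _)} _ none =
  none ([ w ] , mkFactorization (++-identityʳ w) (nyldon ∷ []) [-])
  where
  nyldon : Nyldon w
  nyldon = Equivalence.from (nyldon-unfold w)
    (inj₂ (s≤s (s≤s z≤n) , λ (γs , _ , fact) → none (γs , fact)))

-- Otherwise `x ∷ γs` would be a forbidden factorization of `x ++ y`.
nyldon-irreducible : ∀ {x y γs} → Nyldon (x ++ y) → Nyldon x → y ≢ [] →
                     IsNyldonFactorization y γs → ¬ Linked _≼_ (x ∷ γs)
nyldon-irreducible {y = y} {γs = []} _ _ y≢[] (mkFactorization refl _ _) _ = y≢[] refl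
nyldon-irreducible {x} {y} {γs = γ ∷ γs} nyl nyl-x y≢[] (mkFactorization c≡ ps _) mono
  with Equivalence.to (nyldon-unfold (x ++ y)) nyl
... | inj₁ |xy|≡1  = two x y (nyldon-≢[] nyl-x) y≢[] |xy|≡1
  where
  two : ∀ u v → u ≢ [] → v ≢ [] → length (u ++ v) ≢ 1
  two []          _       u≢[] _    _  = u≢[] refl
  two (_ ∷ [])    []      _    v≢[] _  = v≢[] refl
  two (_ ∷ [])    (_ ∷ _) _    _    ()
  two (_ ∷ _ ∷ _) _       _    _    ()
... | inj₂ (_ , none) =
  none (x ∷ γ ∷ γs , s≤s (s≤s z≤n) , mkFactorization (cong (x ++_) c≡) (nyl-x ∷ ps) mono)

-- The iterated substitution.

expand : Letter → Word → Word
expand d []      = []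
expand d (b ∷ w) = b ∷ a ∷ expand d w
expand d (a ∷ w) = d ∷ expand d w

expand-++ : ∀ d u v → expand d (u ++ v) ≡ expand d u ++ expand d v
expand-++ d []      v = refl
expand-++ d (a ∷ u) v = cong (d ∷_) (expand-++ d u v)
expand-++ d (b ∷ u) v = cong (λ w → b ∷ a ∷ w) (expand-++ d u v)

expand-[] : ∀ d w → expand d w ≡ [] → w ≡ []
expand-[] d []      _ = refl
expand-[] d (a ∷ w) ()
expand-[] d (b ∷ w) ()

expand-a-StartsB : ∀ {w} → StartsB (expand a w) → StartsB w
expand-a-StartsB {b ∷ _} _ = starts
expand-a-StartsB {a ∷ _} ()
expand-a-StartsB {[]} ()

-- The image of a letter can contain b only in first position, so a cut in front of b never splits
-- such an image.
expand-cut : ∀ d s {r} w → StartsB r → s ++ r ≡ expand d w →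
             ∃[ v ] ∃[ v′ ] (w ≡ v ++ v′ × s ≡ expand d v × r ≡ expand d v′)
expand-cut d []          w       _      eq = [] , w , refl , refl , eq
expand-cut d (x ∷ s)     (a ∷ w) rb     eq with ∷-injective eq
... | refl , eq′ with expand-cut d s w rb eq′
... | v , v′ , refl , refl , eq″ = a ∷ v , v′ , refl , refl , eq″
expand-cut d (x ∷ [])    (b ∷ w) starts ()
expand-cut d (x ∷ y ∷ s) (b ∷ w) rb     eq with ∷-injective eq
... | refl , eq′ with ∷-injective eq′
... | refl , eq″ with expand-cut d s w rb eq″
... | v , v′ , refl , refl , eq‴ = b ∷ v , v′ , refl , refl , eq‴

StartsB-concat : ∀ {u us} → All StartsB (u ∷ us) → StartsB (concat (u ∷ us))
StartsB-concat (starts ∷ _) = starts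

expand-cuts : ∀ d {us} w → All StartsB us → concat us ≡ expand d w →
              ∃[ vs ] (us ≡ map (expand d) vs × concat vs ≡ w)
expand-cuts d w [] eq = [] , refl , sym (expand-[] d w (sym eq))
expand-cuts d {u ∷ []} w (_ ∷ []) eq =
  [ w ] , cong [_] (trans (sym (++-identityʳ u)) eq) , ++-identityʳ w
expand-cuts d {u ∷ _ ∷ _} w (_ ∷ bs) eq with expand-cut d u w (StartsB-concat bs) eq
... | v , v′ , refl , refl , eq′ with expand-cuts d v′ bs eq′
... | vs , eqs , refl = v ∷ vs , cong (expand d v ∷_) eqs , refl

h : ℕ → Word → Word
h zero    w = expand a w
h (suc j) w = h j (expand b w)

h-++ : ∀ j u v → h j (u ++ v) ≡ h j u ++ h j v
h-++ zero    u v = expand-++ a u v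
h-++ (suc j) u v = trans (cong (h j) (expand-++ b u v)) (h-++ j (expand b u) (expand b v))

h-[] : ∀ j w → h j w ≡ [] → w ≡ []
h-[] zero    w eq = expand-[] a w eq
h-[] (suc j) w eq = expand-[] b w (h-[] j (expand b w) eq)

h-∷-≢[] : ∀ j {c w} → h j (c ∷ w) ≢ []
h-∷-≢[] j eq with h-[] j _ eq
... | ()

h-StartsB : ∀ j u → StartsB (h j (b ∷ u))
h-StartsB zero    u = starts
h-StartsB (suc j) u = h-StartsB j (a ∷ expand b u)

-- Removal of a final letter.

-- Length one, or the last two letters differ. Excluding aa along with bb makes the condition stable
-- under `expand b`, which sends aa to bb.
data EndsAlternating : Word → Set where
  single : ∀ x → EndsAlternating (x ∷ [])
  ab     : EndsAlternating (a ∷ b ∷ [])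
  ba     : EndsAlternating (b ∷ a ∷ [])
  skip   : ∀ x {y z w} → EndsAlternating (y ∷ z ∷ w) → EndsAlternating (x ∷ y ∷ z ∷ w)

EndsAlternating-++⁻ : ∀ p {c w} → EndsAlternating (p ++ c ∷ w) → EndsAlternating (c ∷ w)
EndsAlternating-++⁻ []          e          = e
EndsAlternating-++⁻ (_ ∷ [])    ab         = single b
EndsAlternating-++⁻ (_ ∷ [])    ba         = single a
EndsAlternating-++⁻ (_ ∷ [])    (skip _ e) = e
EndsAlternating-++⁻ (_ ∷ p@(_ ∷ [])) (skip _ e)    = EndsAlternating-++⁻ p e
EndsAlternating-++⁻ (_ ∷ p@(_ ∷ _ ∷ _)) (skip _ e) = EndsAlternating-++⁻ p e

EndsAlternating-expand : ∀ {w} → EndsAlternating w → EndsAlternating (expand b w)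
EndsAlternating-expand (single a) = single b
EndsAlternating-expand (single b) = ba
EndsAlternating-expand ab         = skip b ba
EndsAlternating-expand ba         = skip b ab
EndsAlternating-expand (skip x {y} {z} {w} e) = prepend x y z (EndsAlternating-expand e)
  where
  prepend : ∀ x y z {w} → EndsAlternating (expand b (y ∷ z ∷ w)) →
            EndsAlternating (expand b (x ∷ y ∷ z ∷ w))
  -- The case split exposes two further letters of the image, as `skip` demands.
  prepend a a a e = skip b e
  prepend a a b e = skip b e
  prepend a b _ e = skip b e
  prepend b a a e = skip b (skip a e)
  prepend b a b e = skip b (skip a e)
  prepend b b _ e = skip b (skip a e)

-- Tail t u allows t to be cut off the end of h j u.  For t = [ a ] the word
-- u must not end in bb: with x = h j [ b ] and x = y a, the word x y may be
-- Nyldon, because y ≺ x.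
data Tail : Word → Word → Set where
  whole   : ∀ {u} → Tail [] u
  chopped : ∀ {u} → EndsAlternating u → Tail [ a ] u

Tail-++⁻ : ∀ p {t c w} → Tail t (p ++ c ∷ w) → Tail t (c ∷ w)
Tail-++⁻ p whole       = whole
Tail-++⁻ p (chopped e) = chopped (EndsAlternating-++⁻ p e)

Tail-expand : ∀ {t w} → Tail t w → Tail t (expand b w)
Tail-expand whole       = whole
Tail-expand (chopped e) = chopped (EndsAlternating-expand e)

-- `t` has at most one letter and `z` at least one, so `t` lies inside `z`.
Tail-split : ∀ {t u} → Tail t u → ∀ γ x {z} → z ≢ [] → γ ++ t ≡ x ++ z →
             ∃[ r ] (γ ≡ x ++ r × r ++ t ≡ z)
Tail-split _           γ       []      _    eq = γ , refl , eq
Tail-split whole       []      (_ ∷ _) _    ()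
Tail-split (chopped _) []      (_ ∷ []) z≢[] eq = ⊥-elim (z≢[] (sym (∷-injectiveʳ eq)))
Tail-split (chopped _) []      (_ ∷ _ ∷ _) _ ()
Tail-split t           (_ ∷ γ) (_ ∷ x) z≢[] eq with ∷-injective eq
... | refl , eq′ with Tail-split t γ x z≢[] eq′
... | r , refl , eq″ = r , refl , eq″

-- Alignment of factorizations with blocks.

-- Only the last factor lacks `t`. The `++ []` gives both constructors the common form
-- `γ ++ t′ ≡ f u` returned by `Image-head`.
data Image (f : Word → Word) (t : Word) : List Word → List Word → Set where
  last : ∀ {γ u} → γ ++ t ≡ f u → Image f t [ γ ] [ u ]
  _∷_  : ∀ {γ u γs us} → γ ++ [] ≡ f u → Image f t γs us → Image f t (γ ∷ γs) (u ∷ us)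

Image-map⁻ : ∀ {f g t γs vs us} → us ≡ map g vs → Image f t γs us → Image (f ∘ g) t γs vs
Image-map⁻ {vs = _ ∷ []}     refl (last eq) = last eq
Image-map⁻ {vs = _ ∷ _}      refl (eq ∷ im) = eq ∷ Image-map⁻ refl im

Image-head : ∀ {f t γ γs u us} → Image f t (γ ∷ γs) (u ∷ us) → Tail t (concat (u ∷ us)) →
             ∃[ t′ ] (γ ++ t′ ≡ f u × Tail t′ u)
Image-head {t = t} {u = u} (last eq) tl = t , eq , subst (Tail t) (++-identityʳ u) tl
Image-head (eq ∷ _)  _  = [] , eq , whole

record Aligned (f : Word → Word) (t : Word) (γs : List Word) (w : Word) : Set where
  constructor aligned
  field
    {pieces} : List Word
    image    : Image f t γs pieces
    startsB  : All StartsB pieces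
    concat≡  : concat pieces ≡ w

-- The induction statement on the level. The tail is carried along because a Fibonacci word without
-- its first letter is some `h j [ b ]` without its final a.
AllAligned : ℕ → Set
AllAligned j = ∀ {t u γs} → Tail t (b ∷ u) → All Nyldon γs → Linked _≼_ γs →
               concat γs ++ t ≡ h j (b ∷ u) → Aligned (h j) t γs (b ∷ u)

aligned-id : ∀ {t γ γs} → StartsB γ → Linked _≼_ (γ ∷ γs) →
             Aligned id t (γ ∷ γs) (concat (γ ∷ γs) ++ t)
aligned-id {t} {γ} starts [-] =
  aligned (last refl) (starts ∷ [])
    (trans (++-identityʳ (γ ++ t)) (cong (_++ t) (sym (++-identityʳ γ))))
aligned-id {t} {γ} {γs} γb@starts (γ≼ ∷ mono) with aligned-id {t} (StartsB-≼ γb γ≼) mono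
... | aligned im bs eq =
  aligned (++-identityʳ γ ∷ im) (starts ∷ bs)
    (trans (cong (γ ++_) eq) (sym (++-assoc γ (concat γs) t)))

no-empty : ∀ {j t u v} → Tail t v → [] ++ t ≢ h j (b ∷ u)
no-empty {j} {u = u} tl eq with h j (b ∷ u) | h-StartsB j u
no-empty whole       () | _ | starts
no-empty (chopped _) () | _ | starts

-- The first factor begins with b, so by monotonicity all do; `expand a` preserves first letters, so
-- the pieces begin with b as well.
allAligned-zero : AllAligned zero
allAligned-zero {u = u} {[]} tl _ _ eq = ⊥-elim (no-empty {zero} {u = u} tl eq)
allAligned-zero {γs = [] ∷ _} _ (nyl ∷ _) _ _ = ⊥-elim (nyldon-≢[] nyl refl)
allAligned-zero {t} {u} {(c ∷ γ) ∷ γs} tl nyls mono eq with ∷-injectiveˡ eq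
... | refl with aligned-id {t} starts mono
... | aligned im bs eq′ with expand-cuts a (b ∷ u) bs (trans eq′ eq)
... | vs , refl , eq″ = aligned (Image-map⁻ refl im) (unexpand vs bs) eq″
  where
  unexpand : ∀ vs → All StartsB (map (expand a) vs) → All StartsB vs
  unexpand []       []       = []
  unexpand (_ ∷ vs) (s ∷ ss) = expand-a-StartsB s ∷ unexpand vs ss

-- Blocks and the induction on the level.

undivided : ∀ {u v vs} → All StartsB (u ∷ v ∷ vs) → concat (u ∷ v ∷ vs) ≢ [ b ]
undivided (starts {w} ∷ starts ∷ _) eq with ++-conicalʳ w _ (∷-injectiveʳ eq)
... | ()

-- By alignment, two or more factors would yield two or more pieces beginning with b, too many for
-- `[ b ]`. This serves both inside the induction and for the final result.
nyldon-block : ∀ {j t w} → AllAligned j → Tail t [ b ] → w ++ t ≡ h j [ b ] → Nyldon w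
nyldon-block {j} {w = []} ih tl eq = ⊥-elim (no-empty {j} tl eq)
nyldon-block {w = _ ∷ []} _  _  _  = inj₁ refl
nyldon-block {j} {t} {w@(_ ∷ _ ∷ _)} ih tl eq =
  Equivalence.from (nyldon-unfold w) (inj₂ (s≤s (s≤s z≤n) , none))
  where
  none : ¬ (∃[ γs ] (length γs ≥ 2 × IsNyldonFactorization w γs))
  none (γs , 2≤ , mkFactorization c≡ nyls mono)
    with ih {u = []} tl nyls mono (trans (cong (_++ t) c≡) eq)
  none (_ ∷ [] , s≤s () , _) | aligned (last _) _ _
  none (_ , _ , _) | aligned (_ ∷ last _) bs c≡ = undivided bs c≡
  none (_ , _ , _) | aligned (_ ∷ _ ∷ _) bs c≡ = undivided bs c≡

-- Only the block h j [ b ] itself, chopped, would be less than h j [ b ]; then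
-- w is empty and b ∷ b ∷ w does not end alternating.
block-≼ : ∀ {j t γ γs us w} → Tail t (b ∷ b ∷ w) → Image (h j) t (γ ∷ γs) us →
          All StartsB us → concat us ≡ b ∷ w → h j [ b ] ≼ γ
block-≼ {j} {γ = γ} tl (_∷_ {u = b ∷ u} eq _) (starts ∷ _) _ =
  subst (h j [ b ] ≼_) (trans (sym (h-++ j [ b ] u)) (trans (sym eq) (++-identityʳ γ)))
    (≼-++ _ _)
block-≼ {j} {γ = γ} whole (last {u = b ∷ u} eq) (starts ∷ _) _ =
  subst (h j [ b ] ≼_) (trans (sym (h-++ j [ b ] u)) (trans (sym eq) (++-identityʳ γ)))
    (≼-++ _ _)
block-≼ {j} (chopped (skip _ _)) (last {u = b ∷ []} eq) (starts ∷ _) ()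
block-≼ {j} {γ = γ} tl@(chopped (skip _ _)) (last {u = b ∷ u@(_ ∷ _)} eq) (starts ∷ _) _
  with Tail-split tl γ (h j [ b ]) (h-∷-≢[] j) (trans eq (h-++ j [ b ] u))
... | r , refl , _ = ≼-++ _ r

-- The leading `h j [ b ]` is Nyldon and, by `block-≼`, at most the first factor of the remainder,
-- so it can be prepended to any factorization of the remainder.
¬nyldon-double : ∀ {j t δ w} → AllAligned j → Tail t (b ∷ b ∷ w) →
                 δ ++ t ≡ h j (b ∷ b ∷ w) → ¬ Nyldon δ
¬nyldon-double {j} {t} {δ} {w} ih tl eq nyl
  with Tail-split tl δ (h j [ b ]) (h-∷-≢[] j) (trans eq (h-++ j [ b ] (b ∷ w)))
... | r , refl , eqr = factorization-¬¬ r≢[] contra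
  where
  tl′ = Tail-++⁻ [ b ] tl
  r≢[] : r ≢ []
  r≢[] refl = no-empty {j} {u = w} tl′ eqr
  contra : ¬ (∃[ γs ] IsNyldonFactorization r γs)
  contra ([] , mkFactorization refl _ _) = r≢[] refl
  contra (δ₁ ∷ δs , fact@(mkFactorization c≡ nyls mono))
    with ih tl′ nyls mono (trans (cong (_++ t) c≡) eqr)
  ... | aligned im bs eq =
    nyldon-irreducible nyl
      (nyldon-block {j} ih whole (++-identityʳ _)) r≢[] fact (block-≼ {j} tl im bs eq ∷ mono)

-- Under `expand b`, the letter a becomes b and any next letter becomes a word beginning with b, so
-- a nonempty `v` gives the double block bb.
no-small-start : ∀ {j t γ δ u v} → AllAligned j →
                 γ ++ [] ≡ h (suc j) (b ∷ u) → γ ≼ δ → Nyldon δ →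
                 Tail t (a ∷ v) → δ ++ t ≢ h (suc j) (a ∷ v)
-- Here `δ` is a prefix of `h j [ b ]`, which `γ` properly extends, so `γ ≼ δ` fails.
no-small-start {j} {t} {γ} {δ} {u} {[]} ih eqγ γ≼δ _ _ eqδ =
  ++-⋠ δ longer (subst (_≼ δ) γ≡ γ≼δ)
  where
  y : Word
  y = h j (a ∷ expand b u)
  γ≡ : γ ≡ δ ++ (t ++ y)
  γ≡ = begin
    γ              ≡⟨ ++-identityʳ γ ⟨
    γ ++ []        ≡⟨ eqγ ⟩
    h j (b ∷ a ∷ expand b u) ≡⟨ h-++ j [ b ] (a ∷ expand b u) ⟩
    h j [ b ] ++ y ≡⟨ cong (_++ y) eqδ ⟨
    (δ ++ t) ++ y  ≡⟨ ++-assoc δ t y ⟩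
    δ ++ (t ++ y)  ∎
    where open ≡-Reasoning
  longer : t ++ y ≢ []
  longer eq = h-∷-≢[] j (++-conicalʳ t y eq)
no-small-start {j} {v = a ∷ v} ih _ _ nyl tl eqδ =
  ¬nyldon-double {j} {w = expand b v} ih (Tail-expand tl) eqδ nyl
no-small-start {j} {v = b ∷ v} ih _ _ nyl tl eqδ =
  ¬nyldon-double {j} {w = a ∷ expand b v} ih (Tail-expand tl) eqδ nyl

-- Runs from left to right, since excluding a piece that begins with a requires its predecessor to
-- begin with b.
all-startsB : ∀ {j t γ γs u us} → AllAligned j →
              Image (h (suc j)) t (γ ∷ γs) ((b ∷ u) ∷ us) →
              All StartsB (map (expand b) us) → Tail t (concat ((b ∷ u) ∷ us)) →
              All Nyldon γs → Linked _≼_ (γ ∷ γs) → All StartsB us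
all-startsB ih (last _) _ _ _ _ = []
all-startsB {us = [] ∷ _} _ _ (() ∷ _) _ _ _
all-startsB {j} {γs = _ ∷ _} {u = u} {us = (b ∷ _) ∷ _} ih (_ ∷ im) (_ ∷ bs) tl (_ ∷ nyls) (_ ∷ mono) =
  starts ∷ all-startsB {j} ih im bs (Tail-++⁻ (b ∷ u) tl) nyls mono
all-startsB {j} {γs = _ ∷ _} {u = u} {us = (a ∷ v) ∷ _} ih (eq ∷ im) _ tl (nyl ∷ _) (γ≼δ ∷ _)
  with Image-head im (Tail-++⁻ (b ∷ u) tl)
... | _ , eq′ , tl′ = ⊥-elim (no-small-start {j} {u = u} {v} ih eq γ≼δ nyl tl′ eq′)

-- The hypothesis puts the cuts in front of letters b of `expand b (b ∷ u)`, hence in front of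
-- images of letters of `b ∷ u`; `all-startsB` excludes the images of a.
allAligned-suc : ∀ {j} → AllAligned j → AllAligned (suc j)
allAligned-suc {j} ih {t} {u} {γs} tl nyls mono eq with ih (Tail-expand tl) nyls mono eq
... | aligned im bs eq′ with expand-cuts b (b ∷ u) bs eq′
... | vs , refl , eq″ = finish vs (Image-map⁻ refl im) bs eq″ nyls mono
  where
  finish : ∀ {γs} vs → Image (h (suc j)) t γs vs → All StartsB (map (expand b) vs) →
           concat vs ≡ b ∷ u → All Nyldon γs → Linked _≼_ γs →
           Aligned (h (suc j)) t γs (b ∷ u)
  finish {[]} _ () _ _ _ _
  finish [] () _ _ _ _
  finish ([] ∷ _) _ (() ∷ _) _ _ _
  finish ((a ∷ _) ∷ _) _ _ () _ _
  finish {_ ∷ _} ((b ∷ v) ∷ vs) im (_ ∷ bs) eq (_ ∷ nyls) mono =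
    aligned im
      (starts ∷ all-startsB {j} ih im bs (subst (Tail t) (sym eq) tl) nyls mono) eq

allAligned : ∀ j → AllAligned j
allAligned zero    = allAligned-zero
allAligned (suc j) = allAligned-suc {j} (allAligned j)

-- Fibonacci words.

F-conjugate : ∀ k → F (suc k) ++ [ a ] ≡ a ∷ h k [ a ] × F (suc (suc k)) ++ [ a ] ≡ a ∷ h k [ b ]
F-conjugate zero    = refl , refl
F-conjugate (suc k) with F-conjugate k
-- `h (suc k) [ a ]` reduces to `h k [ b ]`, so `eqb` is the first half; in the second, the final a
-- is moved leftwards past each Fibonacci factor.
... | eqa , eqb = eqb , (begin
  (F (suc (suc k)) ++ F (suc k)) ++ [ a ]  ≡⟨ ++-assoc (F (suc (suc k))) (F (suc k)) [ a ] ⟩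
  F (suc (suc k)) ++ (F (suc k) ++ [ a ])  ≡⟨ cong (F (suc (suc k)) ++_) eqa ⟩
  F (suc (suc k)) ++ a ∷ h k [ a ]         ≡⟨ ++-assoc (F (suc (suc k))) [ a ] (h k [ a ]) ⟨
  (F (suc (suc k)) ++ [ a ]) ++ h k [ a ]  ≡⟨ cong (_++ h k [ a ]) eqb ⟩
  a ∷ h k [ b ] ++ h k [ a ]               ≡⟨ cong (a ∷_) (h-++ k [ b ] [ a ]) ⟨
  a ∷ h (suc k) [ b ]                      ∎)
  where open ≡-Reasoning

theorem1 : (k : ℕ) → k ≥ 2 → IsNyldonFactorization (F k) ([ a ] ∷ (F k [ 2 ⋯ f k ]) ∷ [])
theorem1 (suc (suc k)) (s≤s (s≤s z≤n)) = go (F (suc (suc k))) (proj₂ (F-conjugate k))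
  where
  go : ∀ w → w ++ [ a ] ≡ a ∷ h k [ b ] →
       IsNyldonFactorization w ([ a ] ∷ (w [ 2 ⋯ length w ]) ∷ [])
  go []      eq = ⊥-elim (h-∷-≢[] k (sym (∷-injectiveʳ eq)))
  go (c ∷ x) eq with ∷-injective eq
  ... | refl , eq′ rewrite take-all (length x) x ≤-refl =
    mkFactorization (cong (a ∷_) (++-identityʳ x)) (inj₁ refl ∷ nyldon-x ∷ [])
      (inj₁ (a≺ x eq′) ∷ [-])
    where
    nyldon-x : Nyldon x
    -- `x` is the single top-level block without its final a, and `[ b ]` has length one, so the
    -- chop is allowed.
    nyldon-x = nyldon-block {k} (allAligned k) (chopped (single b)) eq′
    a≺ : ∀ x → x ++ [ a ] ≡ h k [ b ] → [ a ] ≺ x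
    a≺ x eq with h k [ b ] | h-StartsB k []
    a≺ []      () | _ | starts
    a≺ (b ∷ _) _  | _ | starts = this a≺b
    a≺ (a ∷ _) () | _ | starts
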